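{- For every $x\in\mathbf{Q}_{>0}$ one has $\mathrm{cds}(1+x)=-\mathrm{cds}(x)$. Hence $\mathrm{cds}$ is 2-periodic on $\mathbf{Q}_{>0}$, i.e. $\mathrm{cds}(x+2)=\mathrm{cds}(x)$ for all $x\in\mathbf{Q}_{>0}$.
   Context: The codenominator $\mathsf{F}:\mathbf{Q}_{>0}\to\mathbf{Z}_{>0}$ is the unique function with $\mathsf{F}(1)=1$ satisfying, for all $x\in\mathbf{Q}_{>0}$, $\mathsf{F}(1+1/x)=\mathsf{F}(x)$ and $\mathsf{F}\left(\frac{1}{1+x}\right)=\mathsf{F}(x)+\mathsf{F}(1/x)$. The codiscriminant $\mathrm{cds}:\mathbf{Q}_{>0}\to\mathbf{Z}$ is defined by $\mathrm{cds}(x):=\mathsf{F}(1/x)^2-\mathsf{F}(x)\mathsf{F}(1/x)-\mathsf{F}(x)^2$. -}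

module Defs where

open import Data.Nat as ℕ using (ℕ; zero; suc; compare; less; equal; greater; s≤s)
import Data.Nat.Properties as ℕ
import Data.Nat.Coprimality as ℕ
open import Data.Integer as ℤ using (ℤ; +_; +[1+_]; _-_; _*_; _^_)
import Data.Integer.Properties as ℤ
open import Data.Product using (∃; _,_)
open import Data.Rational as ℚ using (ℚ; mkℚ; Positive; 1ℚ)
import Data.Rational.Properties as ℚ
import Data.Rational.Unnormalised as ℚᵘ
import Data.Rational.Unnormalised.Properties as ℚᵘ
open import Relation.Binary.PropositionalEquality
  using (_≡_; refl; sym; trans; cong; cong₂)

-- The positivity proof is irrelevant, so _≡_ on ℚ⁺ is equality of rationals.
record ℚ⁺ : Set where
  constructor ⟨_⟩
  field
    value           : ℚ
    .{{isPositive}} : Positive value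

open ℚ⁺ public

infixl 6 _+⁺_
infix  8 1/⁺_

1⁺ : ℚ⁺
1⁺ = ⟨ 1ℚ ⟩

_+⁺_ : ℚ⁺ → ℚ⁺ → ℚ⁺
⟨ p ⟩ +⁺ ⟨ q ⟩ = ⟨ p ℚ.+ q ⟩ {{ℚ.pos+pos⇒pos p q}}

1/⁺_ : ℚ⁺ → ℚ⁺
1/⁺ ⟨ p ⟩ = ⟨ (ℚ.1/ p) {{ℚ.pos⇒nonZero p}} ⟩ {{ℚ.1/pos⇒pos p}}

2⁺ : ℚ⁺
2⁺ = ⟨ + 2 ℚ./ 1 ⟩

record IsCodenominator (F : ℚ⁺ → ℤ) : Set where
  field
    F-positive  : ∀ x → ℤ.Positive (F x)
    F[1]        : F 1⁺ ≡ + 1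
    F[1+1/x]    : ∀ x → F (1⁺ +⁺ 1/⁺ x) ≡ F x
    F[1/[1+x]]  : ∀ x → F (1/⁺ (1⁺ +⁺ x)) ≡ F x ℤ.+ F (1/⁺ x)

cds : (ℚ⁺ → ℤ) → ℚ⁺ → ℤ
cds F x = F (1/⁺ x) ^ 2 - F x * F (1/⁺ x) - F x ^ 2

-- A codenominator exists: run the subtractive Euclidean algorithm on
-- x = (1 + a) / (1 + b), with the first argument of euclid as fuel.

private
  euclid : ℕ → ℕ → ℕ → ℕ
  euclid zero    _ _ = 1
  euclid (suc f) a b with compare a b
  ... | equal _     = 1
  ... | greater b k = euclid f b k
  ... | less a k    = euclid f k a ℕ.+ euclid f a k

  compare-greater : ∀ b k → compare (suc (b ℕ.+ k)) b ≡ greater b k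
  compare-greater zero    k = refl
  compare-greater (suc b) k rewrite compare-greater b k = refl

  compare-less : ∀ a k → compare a (suc (a ℕ.+ k)) ≡ less a k
  compare-less zero    k = refl
  compare-less (suc a) k rewrite compare-less a k = refl

  euclid-positive : ∀ f a b → ℕ.NonZero (euclid f a b)
  euclid-positive zero    _ _ = _
  euclid-positive (suc f) a b with compare a b
  ... | equal _     = _
  ... | greater b k = euclid-positive f b k
  ... | less a k    = ℕ.>-nonZero (ℕ.<-≤-trans
    (ℕ.>-nonZero⁻¹ _ {{euclid-positive f k a}}) (ℕ.m≤m+n _ _))

  euclid-fuel : ∀ f g a b → a ℕ.+ b ℕ.< f → a ℕ.+ b ℕ.< g →
                euclid f a b ≡ euclid g a b
  euclid-fuel (suc f) (suc g) a b (s≤s p) (s≤s q) with compare a b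
  ... | equal _     = refl
  ... | greater b k = euclid-fuel f g b k
    (ℕ.≤-trans (ℕ.m≤m+n _ b) p) (ℕ.≤-trans (ℕ.m≤m+n _ b) q)
  ... | less a k    = cong₂ ℕ._+_
    (euclid-fuel f g k a (lower′ p) (lower′ q))
    (euclid-fuel f g a k (lower p) (lower q))
    where
    lower : ∀ {n} → a ℕ.+ suc (a ℕ.+ k) ℕ.≤ n → suc (a ℕ.+ k) ℕ.≤ n
    lower = ℕ.≤-trans (ℕ.m≤n+m _ a)
    lower′ : ∀ {n} → a ℕ.+ suc (a ℕ.+ k) ℕ.≤ n → suc (k ℕ.+ a) ℕ.≤ n
    lower′ r rewrite ℕ.+-comm k a = lower r

  F₀ : ℕ → ℕ → ℕ
  F₀ a b = euclid (suc (a ℕ.+ b)) a b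

  F₀-greater : ∀ b k → F₀ (suc (b ℕ.+ k)) b ≡ F₀ b k
  F₀-greater b k rewrite compare-greater b k =
    euclid-fuel (suc (b ℕ.+ k) ℕ.+ b) _ b k (ℕ.m≤m+n _ b) ℕ.≤-refl

  F₀-less : ∀ a k → F₀ a (suc (a ℕ.+ k)) ≡ F₀ k a ℕ.+ F₀ a k
  F₀-less a k rewrite compare-less a k = cong₂ ℕ._+_
    (euclid-fuel (a ℕ.+ suc (a ℕ.+ k)) _ k a lower ℕ.≤-refl)
    (euclid-fuel (a ℕ.+ suc (a ℕ.+ k)) _ a k (ℕ.m≤n+m _ a) ℕ.≤-refl)
    where
    lower : suc (k ℕ.+ a) ℕ.≤ a ℕ.+ suc (a ℕ.+ k)
    lower rewrite ℕ.+-comm k a = ℕ.m≤n+m _ a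

  F₁ : ℚ⁺ → ℤ
  F₁ ⟨ mkℚ +[1+ a ] b _ ⟩ = + F₀ a b

  1+-coprime : ∀ {a b} → ℕ.Coprime (suc a) (suc b) →
               ℕ.Coprime (suc (suc (b ℕ.+ a))) (suc b)
  1+-coprime {a} {b} c rewrite sym (ℕ.+-suc b a) = ℕ.coprime-+ c

  1+-mkℚ : ∀ a b .(c : ℕ.Coprime (suc a) (suc b)) →
           1ℚ ℚ.+ mkℚ +[1+ a ] b c ≡
           mkℚ +[1+ suc (b ℕ.+ a) ] b (1+-coprime c)
  1+-mkℚ a b c = ℚ.toℚᵘ-injective (ℚᵘ.≃-trans
    (ℚ.toℚᵘ-homo-+ 1ℚ (mkℚ +[1+ a ] b c))
    (ℚᵘ.*≡* (cong₂ _*_ numerator (cong +[1+_] (sym (ℕ.+-identityʳ b))))))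
    where
    numerator : + 1 * +[1+ b ] ℤ.+ +[1+ a ] * + 1 ≡ +[1+ suc (b ℕ.+ a) ]
    numerator = trans
      (cong₂ ℤ._+_ (ℤ.*-identityˡ +[1+ b ]) (ℤ.*-identityʳ +[1+ a ]))
      (cong +[1+_] (ℕ.+-suc b a))

  ⟨⟩-cong : ∀ {x y : ℚ⁺} → value x ≡ value y → x ≡ y
  ⟨⟩-cong refl = refl

  1+-fraction : ∀ a b .(c : ℕ.Coprime (suc a) (suc b)) →
                1⁺ +⁺ ⟨ mkℚ +[1+ a ] b c ⟩ ≡
                ⟨ mkℚ +[1+ suc (b ℕ.+ a) ] b (1+-coprime c) ⟩
  1+-fraction a b c = ⟨⟩-cong (1+-mkℚ a b c)

  F₁-positive : ∀ x → ℤ.Positive (F₁ x)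
  F₁-positive ⟨ mkℚ +[1+ a ] b _ ⟩ =
    ℤ.positive (ℤ.+<+ (ℕ.>-nonZero⁻¹ _ {{euclid-positive (suc (a ℕ.+ b)) a b}}))

  F₁[1+1/x] : ∀ x → F₁ (1⁺ +⁺ 1/⁺ x) ≡ F₁ x
  F₁[1+1/x] ⟨ mkℚ +[1+ a ] b c ⟩ = trans
    (cong F₁ (1+-fraction b a (ℕ.sym c)))
    (cong +_ (F₀-greater a b))

  F₁[1/[1+x]] : ∀ x → F₁ (1/⁺ (1⁺ +⁺ x)) ≡ F₁ x ℤ.+ F₁ (1/⁺ x)
  F₁[1/[1+x]] ⟨ mkℚ +[1+ a ] b c ⟩ = trans
    (cong (λ y → F₁ (1/⁺ y)) (1+-fraction a b c))
    (cong +_ (F₀-less b a))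

codenominator-exists : ∃ IsCodenominator
codenominator-exists = F₁ , record
  { F-positive = F₁-positive
  ; F[1]       = refl
  ; F[1+1/x]   = F₁[1+1/x]
  ; F[1/[1+x]] = F₁[1/[1+x]]
  }

{-# OPTIONS --safe #-}
module Submission where

open import Defs
open import Data.Integer using (ℤ; +[1+_]; -_; _+_; _-_; _*_; _^_)
import Data.Integer.Properties as ℤ
open import Data.Integer.Solver using (module +-*-Solver)
open import Data.Product using (_×_; _,_)
open import Data.Rational using (mkℚ; 1ℚ)
import Data.Rational.Properties as ℚ
open import Relation.Binary.PropositionalEquality
  using (_≡_; refl; sym; trans; cong; cong₂; module ≡-Reasoning)

-- Put a = F(x) and b = F(1/x). The functional equations say that passing from x to 1 + x replaces
-- the pair (a, b) by (b, a + b), a Fibonacci step. The quadratic form b² - ab - a² changes sign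
-- under this step, as in Cassini's identity; two steps restore it.

⁺-≡ : ∀ {x y : ℚ⁺} → value x ≡ value y → x ≡ y
⁺-≡ refl = refl

1/⁺-involutive : ∀ x → 1/⁺ (1/⁺ x) ≡ x
1/⁺-involutive ⟨ mkℚ +[1+ _ ] _ _ ⟩ = refl

x+2≡1+[1+x] : ∀ x → x +⁺ 2⁺ ≡ 1⁺ +⁺ (1⁺ +⁺ x)
x+2≡1+[1+x] x = ⁺-≡ (trans
  (ℚ.+-comm (value x) (value 2⁺))
  -- The closed sum 1 + 1 computes to `value 2⁺`, so associativity alone suffices here.
  (ℚ.+-assoc 1ℚ 1ℚ (value x)))

module _ {F : ℚ⁺ → ℤ} (isCodenominator : IsCodenominator F) where
  open IsCodenominator isCodenominator

  -- The first functional equation, read at 1/x.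
  F[1+x] : ∀ x → F (1⁺ +⁺ x) ≡ F (1/⁺ x)
  F[1+x] x = trans
    (cong (λ y → F (1⁺ +⁺ y)) (sym (1/⁺-involutive x)))
    (F[1+1/x] (1/⁺ x))

  cds[1+x] : ∀ x → cds F (1⁺ +⁺ x) ≡ - cds F x
  cds[1+x] x = trans
    (cong₂ (λ a b → b ^ 2 - a * b - a ^ 2) (F[1+x] x) (F[1/[1+x]] x))
    (expand (F x) (F (1/⁺ x)))
    where
    open +-*-Solver
    -- With φ the golden ratio, the form is the norm of b - aφ, and the Fibonacci step is
    -- multiplication by 1 - φ, a unit of norm -1.
    expand : ∀ a b → (a + b) ^ 2 - b * (a + b) - b ^ 2 ≡
                     - (b ^ 2 - a * b - a ^ 2)
    expand = solve 2
      (λ a b → (a :+ b) :^ 2 :- b :* (a :+ b) :- b :^ 2 :=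
               :- (b :^ 2 :- a :* b :- a :^ 2))
      refl

  cds[x+2] : ∀ x → cds F (x +⁺ 2⁺) ≡ cds F x
  cds[x+2] x = begin
    cds F (x +⁺ 2⁺)          ≡⟨ cong (cds F) (x+2≡1+[1+x] x) ⟩
    cds F (1⁺ +⁺ (1⁺ +⁺ x))  ≡⟨ cds[1+x] (1⁺ +⁺ x) ⟩
    - cds F (1⁺ +⁺ x)        ≡⟨ cong -_ (cds[1+x] x) ⟩
    - - cds F x              ≡⟨ ℤ.neg-involutive (cds F x) ⟩
    cds F x                  ∎
    where open ≡-Reasoning

lemma1 : (F : ℚ⁺ → ℤ) → IsCodenominator F →
    (∀ (x : ℚ⁺) → cds F (1⁺ +⁺ x) ≡ - cds F x) ×
    (∀ (x : ℚ⁺) → cds F (x +⁺ 2⁺) ≡ cds F x)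
lemma1 F isCodenominator = cds[1+x] isCodenominator , cds[x+2] isCodenominator
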